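{- Let $m,n\ge1$ and let $T\subseteq\{1,\dots,m\}\times\{1,\dots,n\}$. Then $T$ is an hv-convex polyomino if and only if its complement $\overline{T}$ in the grid $\{1,\dots,m\}\times\{1,\dots,n\}$ can be written as $\overline{T}=A\cup B\cup C\cup D$, where $A,B,C,D$ are pairwise disjoint corner regions (upper-left, upper-right, lower-left and lower-right, respectively) such that (i) $(i-1,j-1)\in A$ implies $(i,j)\notin D$, and (ii) $(i-1,j+1)\in B$ implies $(i,j)\notin C$.
   Context: Cells of the $m\times n$ grid are pairs $(i,j)$ with row index $i\in\{1,\dots,m\}$ (row 1 at the top) and column index $j\in\{1,\dots,n\}$ (column 1 at the left). A set $T$ of cells is a polyomino if the graph whose vertices are the cells of $T$, with $(i,j)$ and $(i',j')$ adjacent iff $|i-i'|+|j-j'|\le 1$, is connected (the empty set is regarded as connected). $T$ is h-convex if $(i,k),(i,l)\in T$ implies $(i,j)\in T$ for all $k\le j\le l$; v-convexity is defined analogously for columns; $T$ is hv-convex if it is both. Corner regions are (possibly empty) sets of cells of the grid. $A$ is an upper-left corner region if, for every cell $(i,j)$ of the grid, $(i+1,j)\in A$ or $(i,j+1)\in A$ implies $(i,j)\in A$. Analogously: $B$ is an upper-right corner region if $(i+1,j)\in B$ or $(i,j-1)\in B$ implies $(i,j)\in B$; $C$ is a lower-left corner region if $(i-1,j)\in C$ or $(i,j+1)\in C$ implies $(i,j)\in C$; $D$ is a lower-right corner region if $(i-1,j)\in D$ or $(i,j-1)\in D$ implies $(i,j)\in D$ (in each case for every cell $(i,j)$ of the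 grid). -}

module Defs where

open import Data.Bool using (Bool; not; _∨_) renaming (T to IsTrue)
open import Data.Fin using (Fin; toℕ; _≤_)
open import Data.Nat as ℕ using (ℕ; suc; _+_; ∣_-_∣)
open import Data.Product using (∃; _×_; _,_; proj₁)
open import Function using (_on_)
open import Relation.Binary.Construct.Closure.ReflexiveTransitive using (Star)
open import Relation.Binary.PropositionalEquality using (_≡_)
open import Relation.Nullary using (¬_)

infix 4 _⋖_

-- Indices are 0-based: the grid cell (i , j) of {1,…,m} × {1,…,n}
-- is represented by (i - 1 , j - 1).
Cell : ℕ → ℕ → Set
Cell m n = Fin m × Fin n

-- Subsets of the finite grid, given by their indicator functions.
CellSet : ℕ → ℕ → Set
CellSet m n = Cell m n → Bool

-- k ⋖ k′ says k′ = k + 1, both indices lying in the grid.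
_⋖_ : ∀ {k} → Fin k → Fin k → Set
k ⋖ k′ = toℕ k′ ≡ suc (toℕ k)

Adjacent : ∀ {m n} → Cell m n → Cell m n → Set
Adjacent (i , j) (i′ , j′) = ∣ toℕ i - toℕ i′ ∣ + ∣ toℕ j - toℕ j′ ∣ ℕ.≤ 1

module _ {m n : ℕ} where

  infix  4 _∈_ _∉_
  infixr 6 _∪_

  _∈_ : Cell m n → CellSet m n → Set
  c ∈ S = IsTrue (S c)

  _∉_ : Cell m n → CellSet m n → Set
  c ∉ S = ¬ (c ∈ S)

  ∁ : CellSet m n → CellSet m n
  ∁ S c = not (S c)

  _∪_ : CellSet m n → CellSet m n → CellSet m n
  (R ∪ S) c = R c ∨ S c

  Disjoint : CellSet m n → CellSet m n → Set
  Disjoint R S = ∀ c → ¬ (c ∈ R × c ∈ S)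

  Vertex : CellSet m n → Set
  Vertex T = ∃ λ c → c ∈ T

  -- Connectedness of the graph induced on T: all cells of a path lie in T.
  -- It holds vacuously for the empty set.
  Polyomino : CellSet m n → Set
  Polyomino T = (u v : Vertex T) → Star (Adjacent on proj₁) u v

  HConvex : CellSet m n → Set
  HConvex T = ∀ i j k l → k ≤ j → j ≤ l → (i , k) ∈ T → (i , l) ∈ T → (i , j) ∈ T

  VConvex : CellSet m n → Set
  VConvex T = ∀ i j k l → k ≤ i → i ≤ l → (k , j) ∈ T → (l , j) ∈ T → (i , j) ∈ T

  HVConvex : CellSet m n → Set
  HVConvex T = HConvex T × VConvex T

  UpperLeft : CellSet m n → Set
  UpperLeft A = (∀ i j i⁺ → i ⋖ i⁺ → (i⁺ , j) ∈ A → (i , j) ∈ A)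
              × (∀ i j j⁺ → j ⋖ j⁺ → (i , j⁺) ∈ A → (i , j) ∈ A)

  UpperRight : CellSet m n → Set
  UpperRight B = (∀ i j i⁺ → i ⋖ i⁺ → (i⁺ , j) ∈ B → (i , j) ∈ B)
               × (∀ i j j⁻ → j⁻ ⋖ j → (i , j⁻) ∈ B → (i , j) ∈ B)

  LowerLeft : CellSet m n → Set
  LowerLeft C = (∀ i j i⁻ → i⁻ ⋖ i → (i⁻ , j) ∈ C → (i , j) ∈ C)
              × (∀ i j j⁺ → j ⋖ j⁺ → (i , j⁺) ∈ C → (i , j) ∈ C)

  LowerRight : CellSet m n → Set
  LowerRight D = (∀ i j i⁻ → i⁻ ⋖ i → (i⁻ , j) ∈ D → (i , j) ∈ D)
               × (∀ i j j⁻ → j⁻ ⋖ j → (i , j⁻) ∈ D → (i , j) ∈ D)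

  PairwiseDisjoint : (A B C D : CellSet m n) → Set
  PairwiseDisjoint A B C D = Disjoint A B × Disjoint A C × Disjoint A D
                           × Disjoint B C × Disjoint B D × Disjoint C D

{-# OPTIONS --safe #-}
-- If the complement of T is such a union of corner regions, convexity is immediate.  For
-- connectedness, suppose T meets row i and some later row, but no column meets T in both row i
-- and row i + 1.  Below a T-cell of row i lies a cell of C (or, symmetrically, of D); moving right
-- along row i + 1 one never leaves C, because (ii) keeps B out of the way, and so one reaches the
-- column of the lower T-cell, which would then lie in C.
--
-- Conversely, let T be nonempty and call a quadrant at a cell free if it misses T.  At a cell
-- outside T, convexity frees a horizontal and a vertical arm, so by connectedness the quadrant
-- between them is free or contains all of T.  Hence some quadrant is free, and A, B, C, D collect
-- the cells whose respective quadrant is free, cut down to disjoint sets by means of a topmost,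
-- bottommost, leftmost and rightmost cell of T.

module Submission where

open import Data.Bool using (true; false; _∨_) renaming (T to IsTrue)
open import Data.Bool.Properties using (T?; T-∨)
open import Data.Empty using (⊥; ⊥-elim)
open import Data.Fin using (Fin; zero; suc; toℕ; _≤_; _<_; _>_) renaming (_≥_ to _≥ᶠ_)
open import Data.Fin.Induction using (<-wellFounded; >-wellFounded)
open import Data.Fin.Properties using (any?; all?; _≤?_; _<?_; toℕ-injective)
open import Data.Nat as ℕ using (ℕ; zero; suc; _≥_; z≤n; s≤s; ∣_-_∣)
import Data.Nat.Properties as ℕ
open import Data.Product using (∃; ∃₂; ∃-syntax; _×_; _,_; proj₁; proj₂)
open import Data.Sum as Sum using (_⊎_; inj₁; inj₂; [_,_]′)
open import Data.Unit using (tt)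
open import Function using (_∘_; _on_; id)
open import Function.Bundles using (_⇔_; mk⇔; Equivalence)
open import Induction.WellFounded using (WellFounded; Acc; acc)
open import Level using (0ℓ)
open import Relation.Binary using (Rel; Decidable)
open import Relation.Binary.Construct.Closure.ReflexiveTransitive using (Star; ε; _◅_; _◅◅_; reverse)
import Relation.Binary.Construct.On as On
open import Relation.Binary.PropositionalEquality using (_≡_; _≗_; refl; sym; cong; subst)
open import Relation.Nullary using (¬_; Dec; yes; no; contradiction; ¬?)
open import Relation.Nullary.Decidable using (⌊_⌋; toWitness; fromWitness; _×-dec_; _→-dec_; decidable-stable)
open import Defs

-- Indices

-- Index 0 is peeled off by shifting `P` along `suc`. The step also receives `a ≤ x` and `y ≤ b`,
-- since later steps are valid only between the two end indices.
ascend : ∀ {k} (P : Fin k → Set) {a b} →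
         (∀ x y → x ⋖ y → a ≤ x → y ≤ b → P x → P y) → a ≤ b → P a → P b
ascend P {zero} {zero} step _ Pa = Pa
ascend {suc (suc _)} P {zero} {suc b} step _ Pa =
  ascend (P ∘ suc) (λ x y e _ y≤b → step (suc x) (suc y) (cong suc e) z≤n (s≤s y≤b)) z≤n
    (step zero (suc zero) refl z≤n (s≤s z≤n) Pa)
ascend P {suc a} {suc b} step (s≤s a≤b) Pa =
  ascend (P ∘ suc) (λ x y e a≤x y≤b → step (suc x) (suc y) (cong suc e) (s≤s a≤x) (s≤s y≤b)) a≤b Pa

-- Ascent of the predicate `P x → P a` starts from the identity, which spares a second recursion.
descend : ∀ {k} (P : Fin k → Set) {a b} →
          (∀ x y → x ⋖ y → a ≤ x → y ≤ b → P y → P x) → a ≤ b → P b → P a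
descend P {a} step a≤b =
  ascend (λ x → P x → P a) (λ x y e a≤x y≤b f → f ∘ step x y e a≤x y≤b) a≤b id

⋖⇒< : ∀ {k} {x y : Fin k} → x ⋖ y → x < y
⋖⇒< e = ℕ.≤-reflexive (sym e)

⋖⇒≤ : ∀ {k} {x y : Fin k} → x ⋖ y → x ≤ y
⋖⇒≤ = ℕ.<⇒≤ ∘ ⋖⇒<

_≥?_ : ∀ {k} → Decidable (_≥ᶠ_ {k} {k})
x ≥? y = y ≤? x

-- Cells

bool-ext : ∀ {a b} → (IsTrue a → IsTrue b) → (IsTrue b → IsTrue a) → a ≡ b
bool-ext {true}  {true}  _ _ = refl
bool-ext {true}  {false} f _ = ⊥-elim (f tt)
bool-ext {false} {true}  _ g = ⊥-elim (g tt)
bool-ext {false} {false} _ _ = refl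

module _ {m n : ℕ} where

  ∉⇒∈∁ : ∀ {T : CellSet m n} c → c ∉ T → c ∈ ∁ T
  ∉⇒∈∁ {T} c c∉T with T c
  ... | true  = c∉T tt
  ... | false = tt

  ∈∁⇒∉ : ∀ {T : CellSet m n} c → c ∈ ∁ T → c ∉ T
  ∈∁⇒∉ {T} c c∈∁T with T c
  ... | false = id

  Adjacent-sym : ∀ {c d : Cell m n} → Adjacent c d → Adjacent d c
  Adjacent-sym {i , j} {i′ , j′} rewrite ℕ.∣-∣-comm (toℕ i) (toℕ i′) | ℕ.∣-∣-comm (toℕ j) (toℕ j′) = id

  Adjacent-refl : ∀ {c : Cell m n} → Adjacent c c
  Adjacent-refl {i , j} rewrite ℕ.∣n-n∣≡0 (toℕ i) | ℕ.∣n-n∣≡0 (toℕ j) = z≤n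

  ∣n-1+n∣≤1 : ∀ k → ∣ k - suc k ∣ ℕ.≤ 1
  ∣n-1+n∣≤1 zero    = ℕ.≤-refl
  ∣n-1+n∣≤1 (suc k) = ∣n-1+n∣≤1 k

  ⋖⇒Adjacentʰ : ∀ {i : Fin m} {j j⁺ : Fin n} → j ⋖ j⁺ → Adjacent (i , j) (i , j⁺)
  ⋖⇒Adjacentʰ {i} {j} e rewrite e | ℕ.∣n-n∣≡0 (toℕ i) = ∣n-1+n∣≤1 (toℕ j)

  ⋖⇒Adjacentᵛ : ∀ {i i⁺ : Fin m} {j : Fin n} → i ⋖ i⁺ → Adjacent (i , j) (i⁺ , j)
  ⋖⇒Adjacentᵛ {i} {j = j} e rewrite e | ℕ.∣n-n∣≡0 (toℕ j) | ℕ.+-identityʳ ∣ toℕ i - suc (toℕ i) ∣ =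
    ∣n-1+n∣≤1 (toℕ i)

  -- Two distances with sum at most 1 cannot both be positive, so a path moves horizontally or
  -- vertically; a stationary move counts as horizontal.
  Adjacent-split : ∀ {x x′ : Fin m} {y y′ : Fin n} → Adjacent (x , y) (x′ , y′) →
                   (x ≡ x′ × ∣ toℕ y - toℕ y′ ∣ ℕ.≤ 1) ⊎ (∣ toℕ x - toℕ x′ ∣ ℕ.≤ 1 × y ≡ y′)
  Adjacent-split {x} {x′} adj with ∣ toℕ x - toℕ x′ ∣ in e
  ... | zero  = inj₁ (toℕ-injective (ℕ.∣m-n∣≡0⇒m≡n e) , adj)
  ... | suc _ with s≤s d≤0 ← adj =
    inj₂ ( s≤s (ℕ.m+n≤o⇒m≤o _ d≤0)
         , toℕ-injective (ℕ.∣m-n∣≡0⇒m≡n (ℕ.n≤0⇒n≡0 (ℕ.m+n≤o⇒n≤o _ d≤0))))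

-- From corner regions to convexity and connectedness

module _ {m n : ℕ} where

  upperLeft-mono : ∀ {A : CellSet m n} → UpperLeft A →
                   ∀ {i i′ j j′} → i ≤ i′ → j ≤ j′ → (i′ , j′) ∈ A → (i , j) ∈ A
  upperLeft-mono {A} (up , left) {i} {j′ = j′} i≤i′ j≤j′ =
    descend (λ y → (i , y) ∈ A) (λ x y e _ _ → left _ x y e) j≤j′
    ∘ descend (λ x → (x , j′) ∈ A) (λ x y e _ _ → up x _ y e) i≤i′

  upperRight-mono : ∀ {B : CellSet m n} → UpperRight B →
                    ∀ {i i′ j j′} → i ≤ i′ → j ≤ j′ → (i′ , j) ∈ B → (i , j′) ∈ B
  upperRight-mono {B} (up , right) {i} {j = j} i≤i′ j≤j′ =
    ascend (λ y → (i , y) ∈ B) (λ x y e _ _ → right _ y x e) j≤j′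
    ∘ descend (λ x → (x , j) ∈ B) (λ x y e _ _ → up x _ y e) i≤i′

  lowerLeft-mono : ∀ {C : CellSet m n} → LowerLeft C →
                   ∀ {i i′ j j′} → i ≤ i′ → j ≤ j′ → (i , j′) ∈ C → (i′ , j) ∈ C
  lowerLeft-mono {C} (down , left) {i′ = i′} {j′ = j′} i≤i′ j≤j′ =
    descend (λ y → (i′ , y) ∈ C) (λ x y e _ _ → left _ x y e) j≤j′
    ∘ ascend (λ x → (x , j′) ∈ C) (λ x y e _ _ → down y _ x e) i≤i′

  lowerRight-mono : ∀ {D : CellSet m n} → LowerRight D →
                    ∀ {i i′ j j′} → i ≤ i′ → j ≤ j′ → (i , j) ∈ D → (i′ , j′) ∈ D
  lowerRight-mono {D} (down , right) {i′ = i′} {j = j} i≤i′ j≤j′ =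
    ascend (λ y → (i′ , y) ∈ D) (λ x y e _ _ → right _ y x e) j≤j′
    ∘ ascend (λ x → (x , j) ∈ D) (λ x y e _ _ → down y _ x e) i≤i′

  ∈-∪⁻ : ∀ {A B C D : CellSet m n} c → c ∈ A ∪ B ∪ C ∪ D → c ∈ A ⊎ c ∈ B ⊎ c ∈ C ⊎ c ∈ D
  ∈-∪⁻ {A} {B} {C} c c∈∪ with Equivalence.to (T-∨ {A c}) c∈∪
  ... | inj₁ a = inj₁ a
  ... | inj₂ bcd with Equivalence.to (T-∨ {B c}) bcd
  ...   | inj₁ b = inj₂ (inj₁ b)
  ...   | inj₂ cd = inj₂ (inj₂ (Equivalence.to (T-∨ {C c}) cd))

  ∈-∪⁺ : ∀ {A B C D : CellSet m n} c → c ∈ A ⊎ c ∈ B ⊎ c ∈ C ⊎ c ∈ D → c ∈ A ∪ B ∪ C ∪ D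
  ∈-∪⁺ {A} {B} {C} c = ∨⁺ {A c} ∘ Sum.map₂ (∨⁺ {B c} ∘ Sum.map₂ (∨⁺ {C c}))
    where
    ∨⁺ : ∀ {a b} → IsTrue a ⊎ IsTrue b → IsTrue (a ∨ b)
    ∨⁺ = Equivalence.from T-∨

module FromRegions {m n : ℕ} {T A B C D : CellSet m n}
  (ul : UpperLeft A) (ur : UpperRight B) (ll : LowerLeft C) (lr : LowerRight D)
  (cover : ∁ T ≗ A ∪ B ∪ C ∪ D)
  (AD : ∀ i j i⁻ j⁻ → i⁻ ⋖ i → j⁻ ⋖ j → (i⁻ , j⁻) ∈ A → (i , j) ∉ D)
  (BC : ∀ i j i⁻ j⁺ → i⁻ ⋖ i → j ⋖ j⁺ → (i⁻ , j⁺) ∈ B → (i , j) ∉ C)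
  where

  split : ∀ {c} → c ∉ T → c ∈ A ⊎ c ∈ B ⊎ c ∈ C ⊎ c ∈ D
  split {c} c∉T = ∈-∪⁻ {A = A} {B} {C} {D} c (subst IsTrue (cover c) (∉⇒∈∁ {T = T} c c∉T))

  region∩T : ∀ {c} → c ∈ A ⊎ c ∈ B ⊎ c ∈ C ⊎ c ∈ D → c ∉ T
  region∩T {c} r = ∈∁⇒∉ {T = T} c (subst IsTrue (sym (cover c)) (∈-∪⁺ {A = A} {B} {C} {D} c r))

  A∩T : ∀ {c} → c ∈ T → c ∉ A
  A∩T c∈T a = region∩T (inj₁ a) c∈T

  B∩T : ∀ {c} → c ∈ T → c ∉ B
  B∩T c∈T b = region∩T (inj₂ (inj₁ b)) c∈T

  C∩T : ∀ {c} → c ∈ T → c ∉ C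
  C∩T c∈T c = region∩T (inj₂ (inj₂ (inj₁ c))) c∈T

  D∩T : ∀ {c} → c ∈ T → c ∉ D
  D∩T c∈T d = region∩T (inj₂ (inj₂ (inj₂ d))) c∈T

  -- A region containing a gap at `j` would spread into `T`: `A` and `C` leftwards to column `k`,
  -- `B` and `D` rightwards to column `l`.
  hConvex : HConvex T
  hConvex i j k l k≤j j≤l k∈T l∈T = decidable-stable (T? _) λ j∉T → case (split j∉T)
    where
    case : (i , j) ∈ A ⊎ (i , j) ∈ B ⊎ (i , j) ∈ C ⊎ (i , j) ∈ D → ⊥
    case (inj₁ a)               = A∩T k∈T (upperLeft-mono ul ℕ.≤-refl k≤j a)
    case (inj₂ (inj₁ b))        = B∩T l∈T (upperRight-mono ur ℕ.≤-refl j≤l b)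
    case (inj₂ (inj₂ (inj₁ c))) = C∩T k∈T (lowerLeft-mono ll ℕ.≤-refl k≤j c)
    case (inj₂ (inj₂ (inj₂ d))) = D∩T l∈T (lowerRight-mono lr ℕ.≤-refl j≤l d)

  vConvex : VConvex T
  vConvex i j k l k≤i i≤l k∈T l∈T = decidable-stable (T? _) λ i∉T → case (split i∉T)
    where
    case : (i , j) ∈ A ⊎ (i , j) ∈ B ⊎ (i , j) ∈ C ⊎ (i , j) ∈ D → ⊥
    case (inj₁ a)               = A∩T k∈T (upperLeft-mono ul k≤i ℕ.≤-refl a)
    case (inj₂ (inj₁ b))        = B∩T k∈T (upperRight-mono ur k≤i ℕ.≤-refl b)
    case (inj₂ (inj₂ (inj₁ c))) = C∩T l∈T (lowerLeft-mono ll i≤l ℕ.≤-refl c)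
    case (inj₂ (inj₂ (inj₂ d))) = D∩T l∈T (lowerRight-mono lr i≤l ℕ.≤-refl d)

  module _ {i i⁺ i′ : Fin m} {j j′ : Fin n} (i⋖i⁺ : i ⋖ i⁺) (i⁺≤i′ : i⁺ ≤ i′)
           (u∈T : (i , j) ∈ T) (v∈T : (i′ , j′) ∈ T)
           (apart : ∀ k → ¬ ((i , k) ∈ T × (i⁺ , k) ∈ T)) where

    -- By `apart` the lower cell is outside `T`, and a cell of `A` or `B` there would spread up into
    -- `T`.
    below-T : ∀ {k} → (i , k) ∈ T → (i⁺ , k) ∈ C ⊎ (i⁺ , k) ∈ D
    below-T {k} k∈T with split (λ k⁺∈T → apart k (k∈T , k⁺∈T))
    ... | inj₁ a          = contradiction (upperLeft-mono ul (⋖⇒≤ i⋖i⁺) ℕ.≤-refl a) (A∩T k∈T)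
    ... | inj₂ (inj₁ b)   = contradiction (upperRight-mono ur (⋖⇒≤ i⋖i⁺) ℕ.≤-refl b) (B∩T k∈T)
    ... | inj₂ (inj₂ c⊎d) = c⊎d

    -- `C` spreads down and left, so from column `j′` or beyond it would swallow the lower cell of
    -- `T`.
    beyond-C : ∀ {k} → (i⁺ , k) ∈ C → k < j′
    beyond-C c = ℕ.≰⇒> λ j′≤k → C∩T v∈T (lowerLeft-mono ll i⁺≤i′ j′≤k c)

    beyond-D : ∀ {k} → (i⁺ , k) ∈ D → j′ < k
    beyond-D d = ℕ.≰⇒> λ k≤j′ → D∩T v∈T (lowerRight-mono lr i⁺≤i′ k≤j′ d)

    -- The cell `(i , y)` decides. If it is in `T`, or in `C` or `D`, then `(i⁺ , y)` is in `C` or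
    -- `D`, and `y ≤ j′` rules out `D`; `A` would spread left to `(i , j)`.
    C-right : ∀ x y → x ⋖ y → j ≤ x → y ≤ j′ → (i⁺ , x) ∈ C → (i⁺ , y) ∈ C
    C-right x y x⋖y j≤x y≤j′ c with T? (T (i , y))
    ... | yes y∈T with below-T y∈T
    ...   | inj₁ c′ = c′
    ...   | inj₂ d  = contradiction y≤j′ (ℕ.<⇒≱ (beyond-D d))
    C-right x y x⋖y j≤x y≤j′ c | no y∉T with split y∉T
    ... | inj₁ a = contradiction (upperLeft-mono ul ℕ.≤-refl (ℕ.≤-trans j≤x (⋖⇒≤ x⋖y)) a) (A∩T u∈T)
    -- This cell of `B` is the upper-right diagonal neighbour of `(i⁺ , x)`, so condition (ii)
    -- applies.
    ... | inj₂ (inj₁ b) = contradiction c (BC _ _ _ _ i⋖i⁺ x⋖y b)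
    ... | inj₂ (inj₂ (inj₁ c′)) = lowerLeft-mono ll (⋖⇒≤ i⋖i⁺) ℕ.≤-refl c′
    ... | inj₂ (inj₂ (inj₂ d)) =
      contradiction y≤j′ (ℕ.<⇒≱ (beyond-D (lowerRight-mono lr (⋖⇒≤ i⋖i⁺) ℕ.≤-refl d)))

    -- The mirrored walk carries `D` left towards `j′`: condition (i) bars `A`, and the cell
    -- `(i , j)` of `T` bars `B`.
    D-left : ∀ x y → x ⋖ y → j′ ≤ x → y ≤ j → (i⁺ , y) ∈ D → (i⁺ , x) ∈ D
    D-left x y x⋖y j′≤x y≤j d with T? (T (i , x))
    ... | yes x∈T with below-T x∈T
    ...   | inj₁ c  = contradiction j′≤x (ℕ.<⇒≱ (beyond-C c))
    ...   | inj₂ d′ = d′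
    D-left x y x⋖y j′≤x y≤j d | no x∉T with split x∉T
    ... | inj₁ a = contradiction d (AD _ _ _ _ i⋖i⁺ x⋖y a)
    ... | inj₂ (inj₁ b) = contradiction (upperRight-mono ur ℕ.≤-refl (ℕ.≤-trans (⋖⇒≤ x⋖y) y≤j) b) (B∩T u∈T)
    ... | inj₂ (inj₂ (inj₁ c)) =
      contradiction j′≤x (ℕ.<⇒≱ (beyond-C (lowerLeft-mono ll (⋖⇒≤ i⋖i⁺) ℕ.≤-refl c)))
    ... | inj₂ (inj₂ (inj₂ d′)) = lowerRight-mono lr (⋖⇒≤ i⋖i⁺) ℕ.≤-refl d′

    not-apart : ⊥
    not-apart with below-T u∈T
    -- The walk ends in column `j′` itself, where the strict bound reads `j′ < j′`.
    ... | inj₁ c = ℕ.<-irrefl refl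
      (beyond-C (ascend (λ k → (i⁺ , k) ∈ C) C-right (ℕ.<⇒≤ (beyond-C c)) c))
    ... | inj₂ d = ℕ.<-irrefl refl
      (beyond-D (descend (λ k → (i⁺ , k) ∈ D) D-left (ℕ.<⇒≤ (beyond-D d)) d))

  rows-meet : ∀ {i i⁺ i′ j j′} → i ⋖ i⁺ → i⁺ ≤ i′ → (i , j) ∈ T → (i′ , j′) ∈ T →
            ∃ λ k → (i , k) ∈ T × (i⁺ , k) ∈ T
  rows-meet {i} {i⁺} i⋖i⁺ i⁺≤i′ u∈T v∈T =
    decidable-stable (any? λ k → T? (T (i , k)) ×-dec T? (T (i⁺ , k)))
      λ none → not-apart i⋖i⁺ i⁺≤i′ u∈T v∈T λ k both → none (k , both)

  -- Paths inside `T`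

  _⇝_ : Vertex T → Vertex T → Set
  _⇝_ = Star (Adjacent on proj₁)

  ⇝-sym : ∀ {u v} → u ⇝ v → v ⇝ u
  ⇝-sym = reverse λ {u} {v} → Adjacent-sym {c = proj₁ u} {proj₁ v}

  row-path-≤ : ∀ {i j j′} (p : (i , j) ∈ T) (q : (i , j′) ∈ T) → j ≤ j′ →
               ((i , j) , p) ⇝ ((i , j′) , q)
  row-path-≤ {i} {j} {j′} p q j≤j′ =
    ascend (λ k → (r : (i , k) ∈ T) → ((i , j) , p) ⇝ ((i , k) , r)) step j≤j′
      -- `r` and `p` may be different proofs for the same cell, hence different vertices; a
      -- stationary move joins them.
      (λ r → Adjacent-refl {c = i , j} ◅ ε) q
    where
    step : ∀ x y → x ⋖ y → j ≤ x → y ≤ j′ →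
           ((r : (i , x) ∈ T) → ((i , j) , p) ⇝ ((i , x) , r)) →
           (r : (i , y) ∈ T) → ((i , j) , p) ⇝ ((i , y) , r)
    step x y x⋖y j≤x y≤j′ path r =
      path (hConvex i x j j′ j≤x (ℕ.≤-trans (⋖⇒≤ x⋖y) y≤j′) p q) ◅◅ (⋖⇒Adjacentʰ {i = i} x⋖y ◅ ε)

  row-path : ∀ {i j j′} (p : (i , j) ∈ T) (q : (i , j′) ∈ T) → ((i , j) , p) ⇝ ((i , j′) , q)
  row-path {j = j} {j′} p q with ℕ.≤-total (toℕ j) (toℕ j′)
  ... | inj₁ j≤j′ = row-path-≤ p q j≤j′
  ... | inj₂ j′≤j = ⇝-sym (row-path-≤ q p j′≤j)

  downward-path : ∀ (u v : Vertex T) → proj₁ (proj₁ u) ≤ proj₁ (proj₁ v) → u ⇝ v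
  downward-path u@((i , j) , p) ((i′ , j′) , q) i≤i′
    with ascend (λ x → ∃₂ λ k (r : (x , k) ∈ T) → u ⇝ ((x , k) , r)) step i≤i′ (j , p , ε)
    where
    step : ∀ x y → x ⋖ y → i ≤ x → y ≤ i′ →
           (∃₂ λ k (r : (x , k) ∈ T) → u ⇝ ((x , k) , r)) →
           (∃₂ λ k (r : (y , k) ∈ T) → u ⇝ ((y , k) , r))
    step x y x⋖y _ y≤i′ (k , r , path) with rows-meet x⋖y y≤i′ r q
    -- Walk along row `x` to a column `l` that also meets `T` in row `y`, then step down.
    ... | l , r′ , s = l , s , path ◅◅ row-path r r′ ◅◅ (⋖⇒Adjacentᵛ {j = l} x⋖y ◅ ε)
  ... | k , r , path = path ◅◅ row-path r q

  polyomino : Polyomino T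
  polyomino u v with ℕ.≤-total (toℕ (proj₁ (proj₁ u))) (toℕ (proj₁ (proj₁ v)))
  ... | inj₁ u≤v = downward-path u v u≤v
  ... | inj₂ v≤u = ⇝-sym (downward-path v u v≤u)

-- From convexity and connectedness to corner regions

module _ {m n : ℕ} {T : CellSet m n} where

  polyomino-invariant : Polyomino T → (P : Cell m n → Set) →
    (∀ {u v} → u ∈ T → v ∈ T → Adjacent u v → P u → P v) →
    ∀ {u v} → u ∈ T → v ∈ T → P u → P v
  polyomino-invariant connected P step u∈T v∈T = along (connected (_ , u∈T) (_ , v∈T))
    where
    along : ∀ {u v : Vertex T} → Star (Adjacent on proj₁) u v → P (proj₁ u) → P (proj₁ v)
    along ε Pu = Pu
    along {_ , u∈T} (_◅_ {j = _ , w∈T} adj path) Pu = along path (step u∈T w∈T adj Pu)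

  -- A path gets past row `a` only by a vertical move, whose two ends share a column; `cut` forbids
  -- exactly that.
  row-cut : Polyomino T → (a : Fin m) →
    (∀ {x x′ y} → (x , y) ∈ T → (x′ , y) ∈ T → x ≤ a → ¬ (a < x′)) →
    ∀ {x y x′ y′} → (x , y) ∈ T → (x′ , y′) ∈ T → x ≤ a → ¬ (a < x′)
  row-cut connected a cut u∈T v∈T x≤a =
    ℕ.≤⇒≯ (polyomino-invariant connected (λ c → proj₁ c ≤ a) step u∈T v∈T x≤a)
    where
    step : ∀ {u v} → u ∈ T → v ∈ T → Adjacent u v → proj₁ u ≤ a → proj₁ v ≤ a
    step {x , y} {x′ , y′} u∈T v∈T adj x≤a with Adjacent-split {x = x} {x′} {y} {y′} adj
    ... | inj₁ (refl , _) = x≤a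
    ... | inj₂ (_ , refl) = ℕ.≮⇒≥ (cut u∈T v∈T x≤a)

  -- Well-founded descent, with the relation left open so that one search serves all four sides of
  -- `T`.
  extremal : (_⊏_ : Rel (Cell m n) 0ℓ) → WellFounded _⊏_ → Decidable _⊏_ →
             ∃ (_∈ T) → ∃ λ u → u ∈ T × (∀ {v} → v ∈ T → ¬ (v ⊏ u))
  extremal _⊏_ wf _⊏?_ (u , u∈T) = go u (wf u) u∈T
    where
    go : ∀ u → Acc _⊏_ u → u ∈ T → ∃ λ u → u ∈ T × (∀ {v} → v ∈ T → ¬ (v ⊏ u))
    go u (acc rec) u∈T with any? (λ x → any? λ y → T? (T (x , y)) ×-dec ((x , y) ⊏? u))
    ... | yes (x , y , v∈T , v⊏u) = go (x , y) (rec v⊏u) v∈T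
    ... | no minimal = u , u∈T , λ {v} v∈T v⊏u → minimal (proj₁ v , proj₂ v , v∈T , v⊏u)

-- Abstracts over the direction in one coordinate, so that one argument covers all four quadrants.
-- `⊏-near` says that a unit move cannot jump over `i`.
record Side {k} (_⊏_ _⊑_ : Rel (Fin k) 0ℓ) : Set where
  field
    _⊏?_   : Decidable _⊏_
    ⊏⇒⊑    : ∀ {x i} → x ⊏ i → x ⊑ i
    ⊑-split : ∀ {x i} → x ⊑ i → x ⊏ i ⊎ x ≡ i
    ⊏-near : ∀ {x x′ i} → x ⊏ i → ∣ toℕ x - toℕ x′ ∣ ℕ.≤ 1 → x′ ⊑ i

before : ∀ {k} → Side {k} _<_ _≤_
before = record
  { _⊏?_ = _<?_
  ; ⊏⇒⊑ = ℕ.<⇒≤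
  ; ⊑-split = Sum.map₂ toℕ-injective ∘ ℕ.m≤n⇒m<n∨m≡n
  ; ⊏-near = λ {x} {x′} x<i d → ℕ.≤-trans (ℕ.m≤n+∣n-m∣ (toℕ x′) (toℕ x))
      (ℕ.≤-trans (ℕ.+-monoʳ-≤ (toℕ x) d) (ℕ.≤-trans (ℕ.≤-reflexive (ℕ.+-comm (toℕ x) 1)) x<i))
  }

after : ∀ {k} → Side {k} _>_ _≥ᶠ_
after = record
  { _⊏?_ = λ x i → i <? x
  ; ⊏⇒⊑ = ℕ.<⇒≤
  ; ⊑-split = Sum.map₂ (sym ∘ toℕ-injective) ∘ ℕ.m≤n⇒m<n∨m≡n
  ; ⊏-near = λ {x} {x′} x>i d → ℕ.s≤s⁻¹ (ℕ.≤-trans x>i (ℕ.≤-trans (ℕ.m≤n+∣m-n∣ (toℕ x) (toℕ x′))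
      (ℕ.≤-trans (ℕ.+-monoʳ-≤ (toℕ x′) d) (ℕ.≤-reflexive (ℕ.+-comm (toℕ x′) 1)))))
  }

-- Quadrants and arms that miss `T`

module _ {m n : ℕ} where

  Free : Rel (Fin m) 0ℓ → Rel (Fin n) 0ℓ → CellSet m n → Cell m n → Set
  Free R S T (i , j) = ∀ x y → R x i → S y j → (x , y) ∉ T

  free? : ∀ {R S} → Decidable R → Decidable S → ∀ T c → Dec (Free R S T c)
  free? R? S? T (i , j) =
    all? λ x → all? λ y → R? x i →-dec (S? y j →-dec ¬? (T? (T (x , y))))

  module _ {R R̄ : Rel (Fin m) 0ℓ} {S S̄ : Rel (Fin n) 0ℓ} (rows : Side R R̄) (cols : Side S S̄) where

    private
      module R = Side rows
      module S = Side cols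

    -- A T-path leaving the open quadrant at (i , j) has to cross one of its two bounding arms.
    quadrant-isolated : ∀ {T : CellSet m n} {i j} → Polyomino T →
      (∀ x → R̄ x i → (x , j) ∉ T) → (∀ y → S̄ y j → (i , y) ∉ T) →
      Free R̄ S̄ T (i , j) ⊎ (∀ {x y} → (x , y) ∈ T → R x i × S y j)
    quadrant-isolated {T} {i} {j} connected column-free row-free
      with any? (λ x → any? λ y → T? (T (x , y)) ×-dec ((x R.⊏? i) ×-dec (y S.⊏? j)))
    ... | no none = inj₁ free
      where
      free : Free R̄ S̄ T (i , j)
      free x y x⊑i y⊑j c∈T with R.⊑-split x⊑i | S.⊑-split y⊑j
      ... | inj₂ refl | _         = row-free y y⊑j c∈T
      ... | inj₁ _    | inj₂ refl = column-free x x⊑i c∈T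
      ... | inj₁ x⊏i  | inj₁ y⊏j  = none (x , y , c∈T , x⊏i , y⊏j)
    ... | yes (_ , _ , c₀∈T , c₀-inside) = inj₂ λ c∈T →
      polyomino-invariant {T = T} connected Inside step c₀∈T c∈T c₀-inside
      where
      Inside : Cell m n → Set
      Inside (x , y) = R x i × S y j

      step : ∀ {u v} → u ∈ T → v ∈ T → Adjacent u v → Inside u → Inside v
      step {x , y} {x′ , y′} _ v∈T adj (x⊏i , y⊏j) with Adjacent-split {x = x} {x′} {y} {y′} adj
      step _ v∈T adj (x⊏i , y⊏j) | inj₁ (refl , d) with S.⊑-split (S.⊏-near y⊏j d)
      ... | inj₁ y′⊏j = x⊏i , y′⊏j
      ... | inj₂ refl = contradiction v∈T (column-free _ (R.⊏⇒⊑ x⊏i))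
      step _ v∈T adj (x⊏i , y⊏j) | inj₂ (d , refl) with R.⊑-split (R.⊏-near x⊏i d)
      ... | inj₁ x′⊏i = x′⊏i , y⊏j
      ... | inj₂ refl = contradiction v∈T (row-free _ (S.⊏⇒⊑ y⊏j))

  -- Cells of `T` on both sides would enclose `(i , j)`, against convexity.
  row-arm : ∀ {T : CellSet m n} {i j} → HConvex T → (i , j) ∉ T →
            (∀ y → y ≤ j → (i , y) ∉ T) ⊎ (∀ y → y ≥ᶠ j → (i , y) ∉ T)
  row-arm {T} {i} {j} convex c∉T with any? (λ y → (y ≤? j) ×-dec T? (T (i , y)))
  ... | yes (y , y≤j , y∈T) = inj₂ λ y′ j≤y′ y′∈T → c∉T (convex i j y y′ y≤j j≤y′ y∈T y′∈T)
  ... | no none = inj₁ λ y y≤j y∈T → none (y , y≤j , y∈T)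

  column-arm : ∀ {T : CellSet m n} {i j} → VConvex T → (i , j) ∉ T →
               (∀ x → x ≤ i → (x , j) ∉ T) ⊎ (∀ x → x ≥ᶠ i → (x , j) ∉ T)
  column-arm {T} {i} {j} convex c∉T with any? (λ x → (x ≤? i) ×-dec T? (T (x , j)))
  ... | yes (x , x≤i , x∈T) = inj₂ λ x′ i≤x′ x′∈T → c∉T (convex i j x x′ x≤i i≤x′ x∈T x′∈T)
  ... | no none = inj₁ λ x x≤i x∈T → none (x , x≤i , x∈T)

-- The four corner regions of a nonempty `T`

module ToRegions {m n : ℕ} {T : CellSet m n}
  (hconvex : HConvex T) (vconvex : VConvex T) (connected : Polyomino T)
  {top bot r s : Fin m} {left right p q : Fin n}
  (topCell : (top , p) ∈ T) (botCell : (bot , q) ∈ T)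
  (leftCell : (r , left) ∈ T) (rightCell : (s , right) ∈ T)
  (top-min : ∀ {x y} → (x , y) ∈ T → top ≤ x) (bot-max : ∀ {x y} → (x , y) ∈ T → x ≤ bot)
  (left-min : ∀ {x y} → (x , y) ∈ T → left ≤ y) (right-max : ∀ {x y} → (x , y) ∈ T → y ≤ right)
  where

  -- In a row above T both upper quadrants are free, and likewise on the other three sides;
  -- the bounds p, q, r, s share these cells out.  The choice of strict and weak bounds
  -- follows a pinwheel around T, which the conditions (i) and (ii) require already when T
  -- is a single cell.
  InA InB InC InD : Cell m n → Set
  InA c@(i , j) = Free _≤_  _≤_  T c × j < p × i ≤ r
  InB c@(i , j) = Free _≤_  _≥ᶠ_ T c × p ≤ j × i < s
  InC c@(i , j) = Free _≥ᶠ_ _≤_  T c × j ≤ q × r < i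
  InD c@(i , j) = Free _≥ᶠ_ _≥ᶠ_ T c × q < j × s ≤ i

  inA? : ∀ c → Dec (InA c)
  inA? c@(i , j) = free? _≤?_ _≤?_ T c ×-dec (j <? p) ×-dec (i ≤? r)

  inB? : ∀ c → Dec (InB c)
  inB? c@(i , j) = free? _≤?_ _≥?_ T c ×-dec (p ≤? j) ×-dec (i <? s)

  inC? : ∀ c → Dec (InC c)
  inC? c@(i , j) = free? _≥?_ _≤?_ T c ×-dec (j ≤? q) ×-dec (r <? i)

  inD? : ∀ c → Dec (InD c)
  inD? c@(i , j) = free? _≥?_ _≥?_ T c ×-dec (q <? j) ×-dec (s ≤? i)

  A B C D : CellSet m n
  A c = ⌊ inA? c ⌋
  B c = ⌊ inB? c ⌋
  C c = ⌊ inC? c ⌋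
  D c = ⌊ inD? c ⌋

  A⁻ : ∀ {c} → c ∈ A → InA c
  A⁻ = toWitness

  B⁻ : ∀ {c} → c ∈ B → InB c
  B⁻ = toWitness

  C⁻ : ∀ {c} → c ∈ C → InC c
  C⁻ = toWitness

  D⁻ : ∀ {c} → c ∈ D → InD c
  D⁻ = toWitness

  upperLeft : UpperLeft A
  upperLeft = (λ i j i⁺ e a → let free , j<p , i⁺≤r = A⁻ {i⁺ , j} a in
                 fromWitness ((λ x y x≤i y≤j → free x y (ℕ.≤-trans x≤i (⋖⇒≤ e)) y≤j)
                              , j<p , ℕ.≤-trans (⋖⇒≤ e) i⁺≤r))
            , (λ i j j⁺ e a → let free , j⁺<p , i≤r = A⁻ {i , j⁺} a in
                 fromWitness ((λ x y x≤i y≤j → free x y x≤i (ℕ.≤-trans y≤j (⋖⇒≤ e)))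
                              , ℕ.<-trans (⋖⇒< e) j⁺<p , i≤r))

  upperRight : UpperRight B
  upperRight = (λ i j i⁺ e b → let free , p≤j , i⁺<s = B⁻ {i⁺ , j} b in
                  fromWitness ((λ x y x≤i j≤y → free x y (ℕ.≤-trans x≤i (⋖⇒≤ e)) j≤y)
                               , p≤j , ℕ.<-trans (⋖⇒< e) i⁺<s))
             , (λ i j j⁻ e b → let free , p≤j⁻ , i<s = B⁻ {i , j⁻} b in
                  fromWitness ((λ x y x≤i j≤y → free x y x≤i (ℕ.≤-trans (⋖⇒≤ e) j≤y))
                               , ℕ.≤-trans p≤j⁻ (⋖⇒≤ e) , i<s))

  lowerLeft : LowerLeft C
  lowerLeft = (λ i j i⁻ e c → let free , j≤q , r<i⁻ = C⁻ {i⁻ , j} c in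
                 fromWitness ((λ x y i≤x y≤j → free x y (ℕ.≤-trans (⋖⇒≤ e) i≤x) y≤j)
                              , j≤q , ℕ.<-trans r<i⁻ (⋖⇒< e)))
            , (λ i j j⁺ e c → let free , j⁺≤q , r<i = C⁻ {i , j⁺} c in
                 fromWitness ((λ x y i≤x y≤j → free x y i≤x (ℕ.≤-trans y≤j (⋖⇒≤ e)))
                              , ℕ.≤-trans (⋖⇒≤ e) j⁺≤q , r<i))

  lowerRight : LowerRight D
  lowerRight = (λ i j i⁻ e d → let free , q<j , s≤i⁻ = D⁻ {i⁻ , j} d in
                  fromWitness ((λ x y i≤x j≤y → free x y (ℕ.≤-trans (⋖⇒≤ e) i≤x) j≤y)
                               , q<j , ℕ.≤-trans s≤i⁻ (⋖⇒≤ e)))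
             , (λ i j j⁻ e d → let free , q<j⁻ , s≤i = D⁻ {i , j⁻} d in
                  fromWitness ((λ x y i≤x j≤y → free x y i≤x (ℕ.≤-trans (⋖⇒≤ e) j≤y))
                               , ℕ.<-trans q<j⁻ (⋖⇒< e) , s≤i))

  -- Equal cells give disjointness, diagonal neighbours give (i).
  A-D-apart : ∀ {a b c d} → toℕ c ℕ.≤ suc (toℕ a) → toℕ d ℕ.≤ suc (toℕ b) →
              InA (a , b) → ¬ InD (c , d)
  A-D-apart {a} {b} {c} {d} c≤1+a d≤1+b (nw , b<p , a≤r) (se , q<d , s≤c) =
    row-cut {T = T} connected a cut topCell botCell top≤a a<bot
    where
    cut : ∀ {x x′ y} → (x , y) ∈ T → (x′ , y) ∈ T → x ≤ a → ¬ (a < x′)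
    cut {x} {x′} {y} u∈T v∈T x≤a a<x′ with y ≤? b
    -- Columns up to `b` miss `T` in the rows up to `a`; all later columns are at least `d` and miss
    -- `T` in the rows after `a`.
    ... | yes y≤b = nw x y x≤a y≤b u∈T
    ... | no  y≰b = se x′ y (ℕ.≤-trans c≤1+a a<x′) (ℕ.≤-trans d≤1+b (ℕ.≰⇒> y≰b)) v∈T

    -- The bounds on `p` and `q` place `T` on both sides of the cut: otherwise `topCell` would fall
    -- into the lower-right quadrant, or `botCell` into the upper-left one.
    top<c : top < c
    top<c = ℕ.≰⇒> λ c≤top → se top p c≤top (ℕ.≤-trans d≤1+b b<p) topCell

    top≤a : top ≤ a
    top≤a = ℕ.s≤s⁻¹ (ℕ.≤-trans top<c c≤1+a)

    a<bot : a < bot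
    a<bot = ℕ.≰⇒> λ bot≤a → nw bot q bot≤a (ℕ.s≤s⁻¹ (ℕ.≤-trans q<d d≤1+b)) botCell

  -- The same cut after row `a`, now with `T` on both sides because `top ≤ r < c ≤ a + 1` and
  -- `a < s ≤ bot`. It yields disjointness and condition (ii).
  B-C-apart : ∀ {a b c d} → toℕ c ℕ.≤ suc (toℕ a) → toℕ b ℕ.≤ suc (toℕ d) →
              InB (a , b) → ¬ InC (c , d)
  B-C-apart {a} {b} {c} {d} c≤1+a b≤1+d (ne , p≤b , a<s) (sw , d≤q , r<c) =
    row-cut {T = T} connected a cut topCell botCell
      (ℕ.s≤s⁻¹ (ℕ.≤-trans (ℕ.≤-<-trans (top-min leftCell) r<c) c≤1+a))
      (ℕ.<-≤-trans a<s (bot-max rightCell))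
    where
    cut : ∀ {x x′ y} → (x , y) ∈ T → (x′ , y) ∈ T → x ≤ a → ¬ (a < x′)
    cut {x} {x′} {y} u∈T v∈T x≤a a<x′ with y ≤? d
    ... | yes y≤d = sw x′ y (ℕ.≤-trans c≤1+a a<x′) y≤d v∈T
    ... | no  y≰d = ne x y x≤a (ℕ.≤-trans b≤1+d (ℕ.≰⇒> y≰d)) u∈T

  -- Regions sharing a side of the grid are separated by complementary bounds at `p`, `r`, `s` or
  -- `q`; only the opposite pairs need connectedness.
  disjoint : PairwiseDisjoint A B C D
  disjoint = (λ c (a , b) → ℕ.<⇒≱ (proj₁ (proj₂ (A⁻ {c} a))) (proj₁ (proj₂ (B⁻ {c} b))))
           , (λ c (a , z) → ℕ.<⇒≱ (proj₂ (proj₂ (C⁻ {c} z))) (proj₂ (proj₂ (A⁻ {c} a))))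
           , (λ c (a , d) → A-D-apart (ℕ.n≤1+n _) (ℕ.n≤1+n _) (A⁻ {c} a) (D⁻ {c} d))
           , (λ c (b , z) → B-C-apart (ℕ.n≤1+n _) (ℕ.n≤1+n _) (B⁻ {c} b) (C⁻ {c} z))
           , (λ c (b , d) → ℕ.<⇒≱ (proj₂ (proj₂ (B⁻ {c} b))) (proj₂ (proj₂ (D⁻ {c} d))))
           , (λ c (z , d) → ℕ.<⇒≱ (proj₁ (proj₂ (D⁻ {c} d))) (proj₁ (proj₂ (C⁻ {c} z))))

  A-D-diagonal : ∀ i j i⁻ j⁻ → i⁻ ⋖ i → j⁻ ⋖ j → (i⁻ , j⁻) ∈ A → (i , j) ∉ D
  A-D-diagonal i j i⁻ j⁻ i⁻⋖i j⁻⋖j a d =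
    A-D-apart (ℕ.≤-reflexive i⁻⋖i) (ℕ.≤-reflexive j⁻⋖j) (A⁻ {i⁻ , j⁻} a) (D⁻ {i , j} d)

  B-C-diagonal : ∀ i j i⁻ j⁺ → i⁻ ⋖ i → j ⋖ j⁺ → (i⁻ , j⁺) ∈ B → (i , j) ∉ C
  B-C-diagonal i j i⁻ j⁺ i⁻⋖i j⋖j⁺ b c =
    B-C-apart (ℕ.≤-reflexive i⁻⋖i) (ℕ.≤-reflexive j⋖j⁺) (B⁻ {i⁻ , j⁺} b) (C⁻ {i , j} c)

  -- Covering the complement

  InSome : Cell m n → Set
  InSome c = InA c ⊎ InB c ⊎ InC c ⊎ InD c

  pattern inA a = inj₁ a
  pattern inB b = inj₂ (inj₁ b)
  pattern inC c = inj₂ (inj₂ (inj₁ c))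
  pattern inD d = inj₂ (inj₂ (inj₂ d))

  -- Column `p` chooses between `A` and `B`; their row bounds follow from `top ≤ r` and `top ≤ s`.
  above-T : ∀ {i} j → i < top → InSome (i , j)
  above-T {i} j i<top with j <? p
  ... | yes j<p = inA ((λ x y x≤i _ c∈T → ℕ.<⇒≱ i<top (ℕ.≤-trans (top-min c∈T) x≤i))
                      , j<p , ℕ.≤-trans (ℕ.<⇒≤ i<top) (top-min leftCell))
  ... | no  j≮p = inB ((λ x y x≤i _ c∈T → ℕ.<⇒≱ i<top (ℕ.≤-trans (top-min c∈T) x≤i))
                      , ℕ.≮⇒≥ j≮p , ℕ.<-≤-trans i<top (top-min rightCell))

  below-T : ∀ {i} j → bot < i → InSome (i , j)
  below-T {i} j bot<i with j ≤? q
  ... | yes j≤q = inC ((λ x y i≤x _ c∈T → ℕ.<⇒≱ bot<i (ℕ.≤-trans i≤x (bot-max c∈T)))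
                      , j≤q , ℕ.≤-<-trans (bot-max leftCell) bot<i)
  ... | no  j≰q = inD ((λ x y i≤x _ c∈T → ℕ.<⇒≱ bot<i (ℕ.≤-trans i≤x (bot-max c∈T)))
                      , ℕ.≰⇒> j≰q , ℕ.≤-trans (bot-max rightCell) (ℕ.<⇒≤ bot<i))

  leftOf-T : ∀ i {j} → j < left → InSome (i , j)
  leftOf-T i {j} j<left with i ≤? r
  ... | yes i≤r = inA ((λ x y _ y≤j c∈T → ℕ.<⇒≱ j<left (ℕ.≤-trans (left-min c∈T) y≤j))
                      , ℕ.<-≤-trans j<left (left-min topCell) , i≤r)
  ... | no  i≰r = inC ((λ x y _ y≤j c∈T → ℕ.<⇒≱ j<left (ℕ.≤-trans (left-min c∈T) y≤j))
                      , ℕ.≤-trans (ℕ.<⇒≤ j<left) (left-min botCell) , ℕ.≰⇒> i≰r)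

  rightOf-T : ∀ i {j} → right < j → InSome (i , j)
  rightOf-T i {j} right<j with i <? s
  ... | yes i<s = inB ((λ x y _ j≤y c∈T → ℕ.<⇒≱ right<j (ℕ.≤-trans j≤y (right-max c∈T)))
                      , ℕ.≤-trans (right-max topCell) (ℕ.<⇒≤ right<j) , i<s)
  ... | no  i≮s = inD ((λ x y _ j≤y c∈T → ℕ.<⇒≱ right<j (ℕ.≤-trans j≤y (right-max c∈T)))
                      , ℕ.≤-<-trans (right-max botCell) right<j , ℕ.≮⇒≥ i≮s)

  -- If a bound of `InA` fails, then freeness at `topCell` or `leftCell` pushes the cell above or to
  -- the left of all of `T`.
  free-NW : ∀ {i j} → Free _≤_ _≤_ T (i , j) → InSome (i , j)
  free-NW {i} {j} free with j <? p | i ≤? r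
  ... | yes j<p | yes i≤r = inA (free , j<p , i≤r)
  ... | no  j≮p | _       = above-T j (ℕ.≰⇒> λ top≤i → free _ _ top≤i (ℕ.≮⇒≥ j≮p) topCell)
  ... | _       | no i≰r  = leftOf-T i (ℕ.≰⇒> λ left≤j → free _ _ (ℕ.≰⇒≥ i≰r) left≤j leftCell)

  free-NE : ∀ {i j} → Free _≤_ _≥ᶠ_ T (i , j) → InSome (i , j)
  free-NE {i} {j} free with p ≤? j | i <? s
  ... | yes p≤j | yes i<s = inB (free , p≤j , i<s)
  ... | no  p≰j | _       = above-T j (ℕ.≰⇒> λ top≤i → free _ _ top≤i (ℕ.≰⇒≥ p≰j) topCell)
  ... | _       | no i≮s  = rightOf-T i (ℕ.≰⇒> λ j≤right → free _ _ (ℕ.≮⇒≥ i≮s) j≤right rightCell)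

  free-SW : ∀ {i j} → Free _≥ᶠ_ _≤_ T (i , j) → InSome (i , j)
  free-SW {i} {j} free with j ≤? q | r <? i
  ... | yes j≤q | yes r<i = inC (free , j≤q , r<i)
  ... | no  j≰q | _       = below-T j (ℕ.≰⇒> λ i≤bot → free _ _ i≤bot (ℕ.≰⇒≥ j≰q) botCell)
  ... | _       | no r≮i  = leftOf-T i (ℕ.≰⇒> λ left≤j → free _ _ (ℕ.≮⇒≥ r≮i) left≤j leftCell)

  free-SE : ∀ {i j} → Free _≥ᶠ_ _≥ᶠ_ T (i , j) → InSome (i , j)
  free-SE {i} {j} free with q <? j | s ≤? i
  ... | yes q<j | yes s≤i = inD (free , q<j , s≤i)
  ... | no  q≮j | _       = below-T j (ℕ.≰⇒> λ i≤bot → free _ _ i≤bot (ℕ.≮⇒≥ q≮j) botCell)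
  ... | _       | no s≰i  = rightOf-T i (ℕ.≰⇒> λ j≤right → free _ _ (ℕ.≰⇒≥ s≰i) j≤right rightCell)

  complement⊆ : ∀ {i j} → (i , j) ∉ T → InSome (i , j)
  complement⊆ {i} {j} c∉T with column-arm {T = T} vconvex c∉T | row-arm {T = T} hconvex c∉T
  ... | inj₁ up | inj₁ left =
    -- If the quadrant is not free it contains all of `T`, so even the bottommost cell lies above
    -- row `i`.
    [ free-NW , (λ inside → below-T j (proj₁ (inside botCell))) ]′
      (quadrant-isolated before before {T} connected up left)
  ... | inj₁ up | inj₂ right =
    [ free-NE , (λ inside → below-T j (proj₁ (inside botCell))) ]′
      (quadrant-isolated before after {T} connected up right)
  ... | inj₂ down | inj₁ left =
    [ free-SW , (λ inside → above-T j (proj₁ (inside topCell))) ]′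
      (quadrant-isolated after before {T} connected down left)
  ... | inj₂ down | inj₂ right =
    [ free-SE , (λ inside → above-T j (proj₁ (inside topCell))) ]′
      (quadrant-isolated after after {T} connected down right)

  ⊆complement : ∀ {c} → InSome c → c ∉ T
  ⊆complement (inA (free , _)) = free _ _ ℕ.≤-refl ℕ.≤-refl
  ⊆complement (inB (free , _)) = free _ _ ℕ.≤-refl ℕ.≤-refl
  ⊆complement (inC (free , _)) = free _ _ ℕ.≤-refl ℕ.≤-refl
  ⊆complement (inD (free , _)) = free _ _ ℕ.≤-refl ℕ.≤-refl

  cover : ∁ T ≗ A ∪ B ∪ C ∪ D
  cover c = bool-ext
    (∈-∪⁺ {A = A} {B} {C} {D} c
      ∘ Sum.map fromWitness (Sum.map fromWitness (Sum.map fromWitness fromWitness))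
      ∘ complement⊆ ∘ ∈∁⇒∉ {T = T} c)
    (∉⇒∈∁ {T = T} c ∘ ⊆complement {c}
      ∘ Sum.map (A⁻ {c}) (Sum.map (B⁻ {c}) (Sum.map (C⁻ {c}) (D⁻ {c})))
      ∘ ∈-∪⁻ {A = A} {B} {C} {D} c)

-- Assembling the equivalence

CornerDecomposition : ∀ {m n} → CellSet m n → Set
CornerDecomposition T =
  ∃[ A ] ∃[ B ] ∃[ C ] ∃[ D ]
    ( UpperLeft A × UpperRight B × LowerLeft C × LowerRight D
    × PairwiseDisjoint A B C D
    × (∁ T ≗ A ∪ B ∪ C ∪ D)
    × (∀ i j i⁻ j⁻ → i⁻ ⋖ i → j⁻ ⋖ j → (i⁻ , j⁻) ∈ A → (i , j) ∉ D)
    × (∀ i j i⁻ j⁺ → i⁻ ⋖ i → j ⋖ j⁺ → (i⁻ , j⁺) ∈ B → (i , j) ∉ C))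

-- An empty `T` has no extremal cells; here `A` is the whole grid and the other regions are empty.
empty-decomposition : ∀ {m n} {T : CellSet m n} → (∀ c → c ∉ T) → CornerDecomposition T
empty-decomposition {T = T} empty =
  (λ _ → true) , (λ _ → false) , (λ _ → false) , (λ _ → false)
  -- Membership in the whole grid reduces to the unit type, so eta supplies the closure proofs.
  , _
  , ((λ _ _ _ _ ()) , (λ _ _ _ _ ()))
  , ((λ _ _ _ _ ()) , (λ _ _ _ _ ()))
  , ((λ _ _ _ _ ()) , (λ _ _ _ _ ()))
  , ((λ _ ()) , (λ _ ()) , (λ _ ()) , (λ _ ()) , (λ _ ()) , (λ _ ()))
  , (λ c → bool-ext _ (λ _ → ∉⇒∈∁ {T = T} c (empty c)))
  , (λ _ _ _ _ _ _ _ ())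
  , (λ _ _ _ _ _ _ ())

nonempty-decomposition : ∀ {m n} {T : CellSet m n} → HVConvex T → Polyomino T →
                         Vertex T → CornerDecomposition T
nonempty-decomposition {T = T} (hconvex , vconvex) connected t
  with extremal {T = T} (_<_ on proj₁) (On.wellFounded proj₁ <-wellFounded) (λ u v → proj₁ u <? proj₁ v) t
     | extremal {T = T} (_>_ on proj₁) (On.wellFounded proj₁ >-wellFounded) (λ u v → proj₁ v <? proj₁ u) t
     | extremal {T = T} (_<_ on proj₂) (On.wellFounded proj₂ <-wellFounded) (λ u v → proj₂ u <? proj₂ v) t
     | extremal {T = T} (_>_ on proj₂) (On.wellFounded proj₂ >-wellFounded) (λ u v → proj₂ v <? proj₂ u) t
... | _ , topCell , top-min | _ , botCell , bot-max | _ , leftCell , left-min | _ , rightCell , right-max =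
  A , B , C , D , upperLeft , upperRight , lowerLeft , lowerRight
  , disjoint , cover , A-D-diagonal , B-C-diagonal
  where
  open ToRegions {T = T} hconvex vconvex connected topCell botCell leftCell rightCell
    (ℕ.≮⇒≥ ∘ top-min) (ℕ.≮⇒≥ ∘ bot-max) (ℕ.≮⇒≥ ∘ left-min) (ℕ.≮⇒≥ ∘ right-max)

lemma1 : ∀ (m n : ℕ) → m ≥ 1 → n ≥ 1 → (T : CellSet m n) →
    (HVConvex T × Polyomino T)
    ⇔
    (∃[ A ] ∃[ B ] ∃[ C ] ∃[ D ]
    ( UpperLeft A × UpperRight B × LowerLeft C × LowerRight D
    × PairwiseDisjoint A B C D
    × (∁ T ≗ A ∪ B ∪ C ∪ D)
    × (∀ i j i⁻ j⁻ → i⁻ ⋖ i → j⁻ ⋖ j → (i⁻ , j⁻) ∈ A → (i , j) ∉ D)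
    × (∀ i j i⁻ j⁺ → i⁻ ⋖ i → j ⋖ j⁺ → (i⁻ , j⁺) ∈ B → (i , j) ∉ C)))
lemma1 m n _ _ T = mk⇔ decompose recompose
  where
  decompose : HVConvex T × Polyomino T → CornerDecomposition T
  decompose (convex , connected) with any? (λ x → any? λ y → T? (T (x , y)))
  ... | yes (x , y , c∈T) = nonempty-decomposition {T = T} convex connected ((x , y) , c∈T)
  ... | no none = empty-decomposition {T = T} λ (x , y) c∈T → none (x , y , c∈T)

  recompose : CornerDecomposition T → HVConvex T × Polyomino T
  recompose (A , B , C , D , ul , ur , ll , lr , _ , cover , AD , BC) = (hConvex , vConvex) , polyomino
    where open FromRegions {T = T} {A} {B} {C} {D} ul ur ll lr cover AD BC
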